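{- Let $U,U'$ be universal machines with Kolmogorov invariance constant $c=c(U,U')$, so that $|K_U(x)-K_{U'}(x)|\le c$ for every string $x$. Fix $d\ge 3$ and, for a universal machine $V$ and deficiency parameter $e$, write $R_V^{(e)}:=\{x: K_V(x)\ge |x|-e\log|x|\}$. Then, for all sufficiently long $x$, $$x\in R_U^{(d)}\Longrightarrow x\in R_{U'}^{(d+1)}\qquad\text{and}\qquad x\in R_{U'}^{(d)}\Longrightarrow x\in R_U^{(d+1)}.$$ Consequently, the density estimates, and conclusions depending only on those estimates, are robust under changing the universal machine, after increasing the logarithmic-deficiency parameter and disregarding finitely many lengths.
   Context: $K_V(x)$ denotes the (unbounded-time) Kolmogorov complexity of the binary string $x$ with respect to the deterministic universal Turing machine $V$; $|x|$ is the length of $x$. The density estimate referred to is: all but an $O(m^{ -e})$ fraction of strings of length $m$ lie in $R_V^{(e)}$. -}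

module Defs where

open import Data.Bool using (Bool)
open import Data.Fin using (Fin; zero)
open import Data.Integer using (+_)
open import Data.List using (List; []; _∷_; length)
open import Data.List.Relation.Unary.All using (All)
open import Data.List.Relation.Unary.Unique.Propositional using (Unique)
open import Data.Maybe using (Maybe; just; nothing)
open import Data.Nat using (ℕ; suc; NonZero; _+_; _*_; _^_; _≤_; ∣_-_∣)
open import Data.Product using (∃; ∃-syntax; _×_; _,_)
open import Data.Rational.Unnormalised as ℚᵘ using (ℚᵘ; 1ℚᵘ)
import Data.Rational.Unnormalised.Properties as ℚᵘₚ
open import Data.Sum using (_⊎_)
open import Function.Bundles using (_⇔_)
open import Level using (0ℓ)
open import Relation.Binary.PropositionalEquality using (_≡_)
open import Relation.Nullary using (¬_)
open import Relation.Unary using (Pred)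

------------------------------------------------------------------------
-- Deterministic one-tape Turing machines

String : Set
String = List Bool

data Symbol (k : ℕ) : Set where
  blank : Symbol k
  bit   : Bool → Symbol k
  extra : Fin k → Symbol k

data Move : Set where
  left stay right : Move

-- The start state is zero; the machine halts where δ is nothing.
record TM : Set where
  field
    #states : ℕ
    #extra  : ℕ
  State : Set
  State = Fin (suc #states)
  Sym : Set
  Sym = Symbol #extra
  field
    δ : State → Sym → Maybe (State × Sym × Move)

-- A tape that is infinite in both directions: the cells to the left of the
-- head and those to its right, nearest first, with blanks beyond the lists.
record Tape (k : ℕ) : Set where
  constructor tape
  field
    leftCells  : List (Symbol k)
    head       : Symbol k
    rightCells : List (Symbol k)

module _ {k : ℕ} where

  move : Move → Tape k → Tape k
  move stay  t                     = t
  move left  (tape []       s rs)  = tape [] blank (s ∷ rs)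
  move left  (tape (l ∷ ls) s rs)  = tape ls l (s ∷ rs)
  move right (tape ls s [])        = tape (s ∷ ls) blank []
  move right (tape ls s (r ∷ rs))  = tape (s ∷ ls) r rs

  write : Symbol k → Tape k → Tape k
  write s (tape ls _ rs) = tape ls s rs

  bits : String → List (Symbol k)
  bits []      = []
  bits (b ∷ x) = bit b ∷ bits x

  input : String → Tape k
  input []      = tape [] blank []
  input (b ∷ x) = tape [] (bit b) (bits x)

  leadingBits : List (Symbol k) → String
  leadingBits (bit b ∷ ss) = b ∷ leadingBits ss
  leadingBits _            = []

  -- The output is read from the head rightwards, up to the first non-bit.
  output : Tape k → String
  output (tape _ s rs) = leadingBits (s ∷ rs)

module _ (M : TM) where
  open TM M

  step : State → Tape #extra → Maybe (State × Tape #extra)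
  step q t with δ q (Tape.head t)
  ... | nothing           = nothing
  ... | just (q′ , s , m) = just (q′ , move m (write s t))

  data Yields (q : State) (t : Tape #extra) (x : String) : Set where
    halt : step q t ≡ nothing → output t ≡ x → Yields q t x
    next : ∀ {q′ t′} → step q t ≡ just (q′ , t′) → Yields q′ t′ x → Yields q t x

infix 4 _on_⇓_
_on_⇓_ : TM → String → String → Set
M on p ⇓ x = Yields M zero (input p) x

Computable : (String → String) → Set
Computable f = ∃[ M ] ∀ p → M on p ⇓ f p

-- U simulates every machine M through an effective translation of programs
-- that lengthens them by at most a constant.  The usual translation
-- p ↦ ⟨M⟩ ++ p, with ⟨M⟩ a self-delimiting code of M, is an instance.
Universal : TM → Set
Universal U = ∀ M → ∃[ τ ] ∃[ a ]
  Computable τ ×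
  (∀ p → length (τ p) ≤ a + length p) ×
  (∀ p x → M on p ⇓ x ⇔ U on τ p ⇓ x)

------------------------------------------------------------------------
-- Kolmogorov complexity

-- K_V(x) = k.  Since K_V is not computable, it is given by its graph.
K[_,_]≡_ : TM → String → ℕ → Set
K[ V , x ]≡ k =
  (∃[ p ] (V on p ⇓ x × length p ≡ k)) ×
  (∀ p → V on p ⇓ x → k ≤ length p)

InvarianceConstant : TM → TM → ℕ → Set
InvarianceConstant U U′ c =
  ∀ x k k′ → K[ U , x ]≡ k → K[ U′ , x ]≡ k′ → ∣ k - k′ ∣ ≤ c

------------------------------------------------------------------------
-- Dedekind reals

record ℝ : Set₁ where
  field
    Lower Upper     : Pred ℚᵘ 0ℓ          -- the rationals below, resp. above
    lower-inhabited : ∃ Lower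
    upper-inhabited : ∃ Upper
    lower-closed    : ∀ {p q} → p ℚᵘ.< q → Lower q → Lower p
    upper-closed    : ∀ {p q} → p ℚᵘ.< q → Upper p → Upper q
    lower-open      : ∀ {p} → Lower p → ∃[ q ] (p ℚᵘ.< q × Lower q)
    upper-open      : ∀ {q} → Upper q → ∃[ p ] (p ℚᵘ.< q × Upper p)
    lower<upper     : ∀ {p q} → Lower p → Upper q → p ℚᵘ.< q
    located         : ∀ {p q} → p ℚᵘ.< q → Lower p ⊎ Upper q

  lower-resp : ∀ {p q} → p ℚᵘ.≃ q → Lower p → Lower q
  lower-resp p≃q l with lower-open l
  ... | _ , p<r , lr = lower-closed (ℚᵘₚ.<-respˡ-≃ p≃q p<r) lr

  upper-resp : ∀ {p q} → p ℚᵘ.≃ q → Upper p → Upper q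
  upper-resp p≃q u with upper-open u
  ... | _ , r<p , ur = upper-closed (ℚᵘₚ.<-respʳ-≃ p≃q r<p) ur

open ℝ

infix 4 _≤ᵣ_
_≤ᵣ_ : ℕ → ℝ → Set
n ≤ᵣ e = ¬ Upper e (+ n ℚᵘ./ 1)

private
  cancel : ∀ q → q ℚᵘ.≃ q ℚᵘ.+ 1ℚᵘ ℚᵘ.- 1ℚᵘ
  cancel q = ℚᵘₚ.≃-sym (ℚᵘₚ.≃-trans (ℚᵘₚ.+-assoc q 1ℚᵘ (ℚᵘ.- 1ℚᵘ))
    (ℚᵘₚ.≃-trans (ℚᵘₚ.+-congʳ q (ℚᵘₚ.+-inverseʳ 1ℚᵘ)) (ℚᵘₚ.+-identityʳ q)))

  cancel′ : ∀ q → q ℚᵘ.- 1ℚᵘ ℚᵘ.+ 1ℚᵘ ℚᵘ.≃ q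
  cancel′ q = ℚᵘₚ.≃-trans (ℚᵘₚ.+-assoc q (ℚᵘ.- 1ℚᵘ) 1ℚᵘ)
    (ℚᵘₚ.≃-trans (ℚᵘₚ.+-congʳ q (ℚᵘₚ.+-inverseˡ 1ℚᵘ)) (ℚᵘₚ.+-identityʳ q))

  shift : ∀ {p q} → p ℚᵘ.< q → p ℚᵘ.- 1ℚᵘ ℚᵘ.< q ℚᵘ.- 1ℚᵘ
  shift = ℚᵘₚ.+-monoˡ-< (ℚᵘ.- 1ℚᵘ)

  unshift : ∀ {p q} → p ℚᵘ.- 1ℚᵘ ℚᵘ.< q ℚᵘ.- 1ℚᵘ → p ℚᵘ.< q
  unshift {p} {q} lt = ℚᵘₚ.<-respˡ-≃ (cancel′ p)
    (ℚᵘₚ.<-respʳ-≃ (cancel′ q) (ℚᵘₚ.+-monoˡ-< 1ℚᵘ lt))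

infixl 6 _+1
_+1 : ℝ → ℝ
e +1 = record
  { Lower           = λ q → Lower e (q ℚᵘ.- 1ℚᵘ)
  ; Upper           = λ q → Upper e (q ℚᵘ.- 1ℚᵘ)
  ; lower-inhabited = let q , l = lower-inhabited e in
                      q ℚᵘ.+ 1ℚᵘ , lower-resp e (cancel q) l
  ; upper-inhabited = let q , u = upper-inhabited e in
                      q ℚᵘ.+ 1ℚᵘ , upper-resp e (cancel q) u
  ; lower-closed    = λ p<q → lower-closed e (shift p<q)
  ; upper-closed    = λ p<q → upper-closed e (shift p<q)
  ; lower-open      = λ {p} l → let q , p<q , l′ = lower-open e l in
                      q ℚᵘ.+ 1ℚᵘ
                      , unshift (ℚᵘₚ.<-respʳ-≃ (cancel q) p<q)
                      , lower-resp e (cancel q) l′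
  ; upper-open      = λ {q} u → let p , p<q , u′ = upper-open e u in
                      p ℚᵘ.+ 1ℚᵘ
                      , unshift (ℚᵘₚ.<-respˡ-≃ (cancel p) p<q)
                      , upper-resp e (cancel p) u′
  ; lower<upper     = λ l u → unshift (lower<upper e l u)
  ; located         = λ p<q → located e (shift p<q)
  }

------------------------------------------------------------------------
-- Logarithmic deficiency and density

-- k ≥ n − e·log₂ n, for n ≥ 1 and e ≥ 0: for every rational a / b > e,
-- n ≤ k + (a / b)·log₂ n, multiplied by b and exponentiated.
infix 4 _≥_−_·log_
_≥_−_·log_ : ℕ → ℕ → ℝ → ℕ → Set
k ≥ n − e ·log m = ∀ a b .{{_ : NonZero b}} → Upper e (+ a ℚᵘ./ b) →
  2 ^ (b * n) ≤ 2 ^ (b * k) * m ^ a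

-- For universal V there is (classically) exactly one k with K_V(x) = k, so
-- bounding every such k is bounding K_V(x).
R : TM → ℝ → Pred String 0ℓ
R V e x = ∀ k → K[ V , x ]≡ k → k ≥ length x − e ·log length x

-- t ≤ C · m^(−e) · 2^m, for m ≥ 1 and e > 0: for every rational
-- 0 ≤ a / b < e, t · m^(a / b) ≤ C · 2^m, raised to the power b.
infix 4 _≤_·_^−_·2^_
_≤_·_^−_·2^_ : ℕ → ℕ → ℕ → ℝ → ℕ → Set
t ≤ C · m ^− e ·2^ n = ∀ a b .{{_ : NonZero b}} → Lower e (+ a ℚᵘ./ b) →
  t ^ b * m ^ a ≤ (C * 2 ^ n) ^ b

-- All but an O(m^(−e)) fraction of the strings of length m lie in S.  As S
-- need not be decidable, the number of exceptions is bounded by bounding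
-- the length of every repetition-free list of them.
AllBut-O[m^−_] : ℝ → Pred String 0ℓ → Set
AllBut-O[m^− e ] S = ∃[ C ] ∃[ m₀ ] ∀ m → m₀ ≤ m →
  ∀ xs → Unique xs → All (λ x → length x ≡ m × ¬ S x) xs →
  length xs ≤ C · m ^− e ·2^ m

DensityEstimate : TM → ℝ → Set
DensityEstimate V e = AllBut-O[m^− e ] (R V e)

-- A conclusion Φ e S about an exponent e and a set of strings S that follows
-- from the estimate for S at e alone.
DependsOnlyOnDensity : ∀ {ℓ} → (ℝ → Pred String 0ℓ → Set ℓ) → Set _
DependsOnlyOnDensity Φ = ∀ e → 3 ≤ᵣ e → ∀ S → AllBut-O[m^− e ] S → Φ e S

-- Passing from U to V, the set for V with parameter d + 1 retains the
-- estimate at the exponent d, satisfies the one at its own exponent d + 1,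
-- and has the corresponding conclusions.
DensityTransfers : TM → TM → ℝ → ∀ ℓ → Set _
DensityTransfers U V d ℓ = DensityEstimate U d →
  AllBut-O[m^− d ] (R V (d +1)) ×
  DensityEstimate V (d +1) ×
  (∀ (Φ : ℝ → Pred String 0ℓ → Set ℓ) → DependsOnlyOnDensity Φ →
    Φ d (R V (d +1)) × Φ (d +1) (R V (d +1)))

{-# OPTIONS --safe #-}
-- Since |K_U(x) − K_U′(x)| ≤ c, passing from one machine to the other costs at
-- most c ≤ log|x| bits once |x| ≥ 2^c, which one more unit of d absorbs; the
-- exceptions for the second machine are then exceptions for the first.  The
-- estimate at the exponent d + 1 itself is the counting bound: pairwise
-- distinct exceptions have pairwise distinct short programs, and there are too
-- few short programs.  K_V(x) exists only up to double negation, which is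
-- harmless as all the inequalities proved are decidable.
module Submission where

open import Defs
open import Algebra.Properties.CommutativeSemigroup using (interchange)
open import Data.Bool using (true; false)
open import Data.Fin using (Fin; zero; suc; fromℕ<)
open import Data.Fin.Properties using (injective⇒≤; any?; fromℕ<-injective)
open import Data.Integer as ℤ using (+_)
import Data.Integer.Properties as ℤₚ
open import Data.Integer.Tactic.RingSolver using (solve-∀)
open import Data.List using (List; []; _∷_; length; lookup)
open import Data.List.Membership.Propositional.Properties using (∈-lookup)
open import Data.List.Relation.Unary.All as All using (All)
open import Data.List.Relation.Unary.Unique.Propositional using (Unique; _∷_)
open import Data.Nat
  using (ℕ; zero; suc; NonZero; >-nonZero; _+_; _*_; _^_; _∸_; _≤_; _<_; z≤n; s≤s; z<s; _⊔_; _≤?_)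
open import Data.Nat.Binary as ℕᵇ using (ℕᵇ; 2[1+_]; 1+[2_])
open import Data.Nat.Binary.Properties using (toℕ-injective)
open import Data.Nat.Induction using (<-rec)
open import Data.Nat.Properties
open import Data.Product using (∃; ∃-syntax; _×_; _,_; proj₁; proj₂)
open import Data.Rational.Unnormalised as ℚᵘ using (*<*; *≡*; 1ℚᵘ)
import Data.Rational.Unnormalised.Properties as ℚᵘₚ
open import Function using (_∘_; _$_)
open import Function.Bundles using (Equivalence)
open import Function.Definitions using (Injective)
open import Level using (0ℓ)
open import Relation.Binary.PropositionalEquality
  using (_≡_; refl; sym; trans; cong; cong₂; subst; subst₂; module ≡-Reasoning)
open import Relation.Nullary using (¬_; yes; no; contradiction)
open import Relation.Nullary.Decidable using (decidable-stable)
open import Relation.Nullary.Negation using (¬¬-Monad; ¬¬-map)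
open import Relation.Unary using (Pred)

open ℝ

-- Powers of natural numbers

^-distribʳ-* : ∀ o m n → (m * n) ^ o ≡ m ^ o * n ^ o
^-distribʳ-* zero    m n = refl
^-distribʳ-* (suc o) m n = trans (cong (m * n *_) (^-distribʳ-* o m n))
  (interchange *-commutativeSemigroup m n (m ^ o) (n ^ o))

^-cancelˡ-≤ : ∀ o .{{_ : NonZero o}} {m n} → m ^ o ≤ n ^ o → m ≤ n
^-cancelˡ-≤ o mᵒ≤nᵒ = ≮⇒≥ λ n<m → <⇒≱ (^-monoˡ-< o n<m) mᵒ≤nᵒ

0^n≡0 : ∀ n .{{_ : NonZero n}} → 0 ^ n ≡ 0
0^n≡0 (suc n) = refl

^-*-swap : ∀ m n o p → (m ^ (n * o)) ^ p ≡ (m ^ (p * o)) ^ n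
^-*-swap m n o p = begin-equality
  (m ^ (n * o)) ^ p  ≡⟨ ^-*-assoc m (n * o) p ⟩
  m ^ (n * o * p)    ≡⟨ cong (m ^_) (*-comm (n * o) p) ⟩
  m ^ (p * (n * o))  ≡⟨ cong (m ^_) (cong (p *_) (*-comm n o)) ⟩
  m ^ (p * (o * n))  ≡⟨ cong (m ^_) (*-assoc p o n) ⟨
  m ^ (p * o * n)    ≡⟨ ^-*-assoc m (p * o) n ⟨
  (m ^ (p * o)) ^ n  ∎
  where open ≤-Reasoning

-- Least elements, injections and an enumeration of strings

-- Without a least element, strong induction refutes `P` at every number, in particular at `n`.
¬¬-least : ∀ {P : Pred ℕ 0ℓ} → ∃ P → ¬ ¬ (∃[ k ] P k × (∀ j → P j → k ≤ j))
¬¬-least {P} (n , Pn) ¬least = <-rec (¬_ ∘ P)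
  (λ k ¬P< Pk → ¬least (k , Pk , λ j Pj → ≮⇒≥ λ j<k → ¬P< j<k Pj)) n Pn

-- If every value were too small, `f` would inject `Fin (suc n)` into `Fin n`.
injective⇒large-value : ∀ {n} (f : Fin n → ℕ) → Injective _≡_ _≡_ f → .{{NonZero n}} →
  ∃[ i ] n ≤ suc (f i)
injective⇒large-value {suc n} f f-inj with any? (λ i → suc n ≤? suc (f i))
... | yes large = large
... | no ¬large = contradiction (injective⇒≤ g-inj) 1+n≰n
  where
  f<n : ∀ i → f i < n
  f<n i = ≰⇒> λ n≤fi → ¬large (i , s≤s n≤fi)

  g-inj : Injective _≡_ _≡_ (λ i → fromℕ< (f<n i))
  g-inj {i} {j} eq = f-inj (fromℕ<-injective (f i) (f j) (f<n i) (f<n j) eq)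

Unique⇒lookup-injective : ∀ {a} {A : Set a} {xs : List A} → Unique xs → Injective _≡_ _≡_ (lookup xs)
Unique⇒lookup-injective (x∉xs ∷ u) {zero}  {zero}  eq = refl
Unique⇒lookup-injective (x∉xs ∷ u) {zero}  {suc j} eq = contradiction eq (All.lookup x∉xs (∈-lookup j))
Unique⇒lookup-injective (x∉xs ∷ u) {suc i} {zero}  eq = contradiction (sym eq) (All.lookup x∉xs (∈-lookup i))
Unique⇒lookup-injective (x∉xs ∷ u) {suc i} {suc j} eq = cong suc (Unique⇒lookup-injective u eq)

-- Bijective binary numeration, under which shorter strings come first.
encode : String → ℕᵇ
encode []          = ℕᵇ.zero
encode (false ∷ p) = 1+[2 encode p ]
encode (true  ∷ p) = 2[1+ encode p ]

decode : ℕᵇ → String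
decode ℕᵇ.zero  = []
decode 1+[2 n ] = false ∷ decode n
decode 2[1+ n ] = true ∷ decode n

decode-encode : ∀ p → decode (encode p) ≡ p
decode-encode []          = refl
decode-encode (false ∷ p) = cong (false ∷_) (decode-encode p)
decode-encode (true  ∷ p) = cong (true ∷_) (decode-encode p)

encode-injective : Injective _≡_ _≡_ encode
encode-injective {p} {q} eq = trans (sym (decode-encode p)) (trans (cong decode eq) (decode-encode q))

index : String → ℕ
index = ℕᵇ.toℕ ∘ encode

index-injective : Injective _≡_ _≡_ index
index-injective = encode-injective ∘ toℕ-injective

-- The strings of length `l` occupy the indices from `2 ^ l - 1` to `2 ^ (l + 1) - 2`; equality
-- holds for the all-`true` strings.
2+index≤2^1+length : ∀ p → 2 + index p ≤ 2 ^ suc (length p)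
2+index≤2^1+length []          = ≤-refl
2+index≤2^1+length (true ∷ p)  = begin
  2 + 2 * suc (index p)  ≡⟨ *-suc 2 (suc (index p)) ⟨
  2 * (2 + index p)      ≤⟨ *-monoʳ-≤ 2 (2+index≤2^1+length p) ⟩
  2 * 2 ^ suc (length p) ∎
  where open ≤-Reasoning
2+index≤2^1+length (false ∷ p) = begin
  3 + 2 * index p        ≤⟨ n≤1+n _ ⟩
  4 + 2 * index p        ≡⟨ *-distribˡ-+ 2 2 (index p) ⟨
  2 * (2 + index p)      ≤⟨ *-monoʳ-≤ 2 (2+index≤2^1+length p) ⟩
  2 * 2 ^ suc (length p) ∎
  where open ≤-Reasoning

-- Determinism and the existence of K

Yields-deterministic : ∀ M {q t x y} → Yields M q t x → Yields M q t y → x ≡ y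
Yields-deterministic M (halt _ x≡)  (halt _ y≡)  = trans (sym x≡) y≡
Yields-deterministic M (halt eq _)  (next eq′ _) = contradiction (trans (sym eq) eq′) λ ()
Yields-deterministic M (next eq _)  (halt eq′ _) = contradiction (trans (sym eq) eq′) λ ()
Yields-deterministic M (next eq ⇓x) (next eq′ ⇓y) with trans (sym eq) eq′
... | refl = Yields-deterministic M ⇓x ⇓y

-- Translating `p` shows that some program of `V` outputs `x`, so the set of lengths of such
-- programs is inhabited.
K-¬¬-exists : ∀ {V} → Universal V → ∀ {M p x} → M on p ⇓ x → ¬ ¬ (∃[ k ] K[ V , x ]≡ k)
K-¬¬-exists {V} univ {M} {p} {x} p⇓x with univ M
... | τ , _ , _ , _ , sim =
  ¬¬-map (λ (k , k≡ , k-min) → k , k≡ , λ q q⇓x → k-min (length q) (q , q⇓x , refl))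
    (¬¬-least {P = λ k → ∃[ q ] (V on q ⇓ x × length q ≡ k)}
      (_ , τ p , Equivalence.to (sim p x) p⇓x , refl))

-- Rational bounds on the deficiency parameter

3≤⇒3≤+1 : ∀ {d} → 3 ≤ᵣ d → 3 ≤ᵣ d +1
3≤⇒3≤+1 {d} 3≤d 2∈Upper = 3≤d (upper-closed d (*<* (ℤ.+<+ (m≤m+n 3 0))) 2∈Upper)

-- Were `a / b` below 1, a negative rational would lie above `d`. This makes `a ∸ b` a true
-- subtraction in `≥-shift`.
Upper+1⇒≤ : ∀ d a b .{{_ : NonZero b}} → 3 ≤ᵣ d → Upper (d +1) (+ a ℚᵘ./ b) → b ≤ a
Upper+1⇒≤ d a b@(suc _) 3≤d u = ≮⇒≥ λ a<b → 3≤d (upper-closed d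
  (ℚᵘₚ.<-trans (ℚᵘₚ.+-monoˡ-< (ℚᵘ.- 1ℚᵘ) (a/b<1 a<b)) (*<* (ℤ.+<+ z<s))) u)
  where
  a/b<1 : a < b → + a ℚᵘ./ b ℚᵘ.< 1ℚᵘ
  a/b<1 a<b = *<* (subst₂ ℤ._<_ (sym (ℤₚ.*-identityʳ (+ a))) (sym (ℤₚ.*-identityˡ (+ b))) (ℤ.+<+ a<b))

Upper+1⇒Upper : ∀ d a b .{{_ : NonZero b}} → Upper (d +1) (+ (b + a) ℚᵘ./ b) → Upper d (+ a ℚᵘ./ b)
Upper+1⇒Upper d a b@(suc _) = upper-resp d (*≡* (begin
  (+ (b + a) ℤ.* + 1 ℤ.+ ℤ.- + 1 ℤ.* + b) ℤ.* + b
    ≡⟨ cong (λ i → (i ℤ.* + 1 ℤ.+ ℤ.- + 1 ℤ.* + b) ℤ.* + b) (ℤₚ.pos-+ b a) ⟩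
  ((+ b ℤ.+ + a) ℤ.* + 1 ℤ.+ ℤ.- + 1 ℤ.* + b) ℤ.* + b
    ≡⟨ identity (+ a) (+ b) ⟩
  + a ℤ.* (+ b ℤ.* + 1)
    ≡⟨ cong (+ a ℤ.*_) (ℤₚ.pos-* b 1) ⟨
  + a ℤ.* + (b * 1) ∎))
  where
  open ≡-Reasoning
  identity : ∀ i j → ((j ℤ.+ i) ℤ.* + 1 ℤ.+ ℤ.- + 1 ℤ.* j) ℤ.* j ≡ i ℤ.* (j ℤ.* + 1)
  identity = solve-∀

Lower-Upper⇒< : ∀ e a b a′ b′ .{{_ : NonZero b}} .{{_ : NonZero b′}} →
  Lower e (+ a ℚᵘ./ b) → Upper e (+ a′ ℚᵘ./ b′) → a * b′ < a′ * b
Lower-Upper⇒< e a b@(suc _) a′ b′@(suc _) l u = ℤₚ.drop‿+<+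
  (subst₂ ℤ._<_ (sym (ℤₚ.pos-* a b′)) (sym (ℤₚ.pos-* a′ b)) (ℚᵘₚ.drop-*<* (lower<upper e l u)))

-- Transfer between the machines

-- Write `a / b` as `1 + r / b`. Then `r / b` lies above `d`, so the hypothesis applies to it, and
-- the remaining factor `n ^ b` absorbs the loss `2 ^ (b * c)`.
≥-shift : ∀ {c n k k′} d → 3 ≤ᵣ d → 2 ^ c ≤ n → k ≤ k′ + c →
  k ≥ n − d ·log n → k′ ≥ n − d +1 ·log n
≥-shift {c} {n} {k} {k′} d 3≤d 2^c≤n k≤k′+c k≥ a b u = begin
  2 ^ (b * n)                               ≤⟨ k≥ r b (Upper+1⇒Upper d r b u′) ⟩
  2 ^ (b * k) * n ^ r                       ≤⟨ *-monoˡ-≤ (n ^ r) (^-monoʳ-≤ 2 (*-monoʳ-≤ b k≤k′+c)) ⟩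
  2 ^ (b * (k′ + c)) * n ^ r                ≡⟨ cong (λ i → 2 ^ i * n ^ r) (*-distribˡ-+ b k′ c) ⟩
  2 ^ (b * k′ + b * c) * n ^ r              ≡⟨ cong (_* n ^ r) (^-distribˡ-+-* 2 (b * k′) (b * c)) ⟩
  2 ^ (b * k′) * 2 ^ (b * c) * n ^ r        ≡⟨ *-assoc (2 ^ (b * k′)) _ _ ⟩
  2 ^ (b * k′) * (2 ^ (b * c) * n ^ r)      ≡⟨ cong (λ i → 2 ^ (b * k′) * (2 ^ i * n ^ r)) (*-comm b c) ⟩
  2 ^ (b * k′) * (2 ^ (c * b) * n ^ r)      ≡⟨ cong (λ i → 2 ^ (b * k′) * (i * n ^ r)) (^-*-assoc 2 c b) ⟨
  2 ^ (b * k′) * ((2 ^ c) ^ b * n ^ r)      ≤⟨ *-monoʳ-≤ (2 ^ (b * k′)) (*-monoˡ-≤ (n ^ r) (^-monoˡ-≤ b 2^c≤n)) ⟩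
  2 ^ (b * k′) * (n ^ b * n ^ r)            ≡⟨ cong (2 ^ (b * k′) *_) (^-distribˡ-+-* n b r) ⟨
  2 ^ (b * k′) * n ^ (b + r)                ≡⟨ cong (λ i → 2 ^ (b * k′) * n ^ i) b+r≡a ⟩
  2 ^ (b * k′) * n ^ a                      ∎
  where
  open ≤-Reasoning
  r = a ∸ b
  b+r≡a : b + r ≡ a
  b+r≡a = m+[n∸m]≡n (Upper+1⇒≤ d a b 3≤d u)
  u′ : Upper (d +1) (+ (b + r) ℚᵘ./ b)
  u′ = subst (λ i → Upper (d +1) (+ i ℚᵘ./ b)) (sym b+r≡a) u

-- The program of `V` witnessing `k′` is simulated by `U`, so K of `x` for `U` exists up to double
-- negation.
R-transfers : ∀ U {V} c → Universal U → InvarianceConstant U V c → ∀ d → 3 ≤ᵣ d →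
  ∀ x → 2 ^ c ≤ length x → R U d x → R V (d +1) x
R-transfers U c univ inv d 3≤d x 2^c≤ x∈R k′ k′≡@((p , p⇓x , _) , _) a b u =
  decidable-stable (_ ≤? _) $ ¬¬-map
    (λ (k , k≡) → ≥-shift d 3≤d 2^c≤
      (≤-trans (m≤n+∣m-n∣ k k′) (+-monoʳ-≤ k′ (inv x k k′ k≡ k′≡))) (x∈R k k≡) a b u)
    (K-¬¬-exists univ p⇓x)

AllBut-mono : ∀ e {S T : Pred String 0ℓ} N → (∀ x → N ≤ length x → S x → T x) →
  AllBut-O[m^− e ] S → AllBut-O[m^− e ] T
AllBut-mono e N S→T (C , m₀ , bound) = C , m₀ ⊔ N , λ m m≥ xs u exs →
  bound m (≤-trans (m≤m⊔n m₀ N) m≥) xs u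
    (All.map (λ { (refl , x∉T) → refl , x∉T ∘ S→T _ (≤-trans (m≤n⊔m m₀ N) m≥) }) exs)

-- The counting bound

-- Raising to the power `b′` gives both sides the common denominator `b * b′`; afterwards a `b`-th
-- root is taken.
exponent-mono : ∀ {m n k} a b a′ b′ .{{_ : NonZero m}} .{{_ : NonZero b}} → a * b′ ≤ a′ * b →
  2 ^ (b * n) ≤ 2 ^ (b * k) * m ^ a → 2 ^ (b′ * n) ≤ 2 ^ (b′ * k) * m ^ a′
exponent-mono {m} {n} {k} a b a′ b′ ab′≤a′b h = ^-cancelˡ-≤ b (begin
  (2 ^ (b′ * n)) ^ b                     ≡⟨ ^-*-swap 2 b′ n b ⟩
  (2 ^ (b * n)) ^ b′                     ≤⟨ ^-monoˡ-≤ b′ h ⟩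
  (2 ^ (b * k) * m ^ a) ^ b′             ≡⟨ ^-distribʳ-* b′ _ _ ⟩
  (2 ^ (b * k)) ^ b′ * (m ^ a) ^ b′      ≡⟨ cong₂ _*_ (^-*-swap 2 b k b′) (^-*-assoc m a b′) ⟩
  (2 ^ (b′ * k)) ^ b * m ^ (a * b′)      ≤⟨ *-monoʳ-≤ ((2 ^ (b′ * k)) ^ b) (^-monoʳ-≤ m ab′≤a′b) ⟩
  (2 ^ (b′ * k)) ^ b * m ^ (a′ * b)      ≡⟨ cong ((2 ^ (b′ * k)) ^ b *_) (^-*-assoc m a′ b) ⟨
  (2 ^ (b′ * k)) ^ b * (m ^ a′) ^ b      ≡⟨ ^-distribʳ-* b _ _ ⟨
  (2 ^ (b′ * k) * m ^ a′) ^ b            ∎)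
  where open ≤-Reasoning

-- The inequality is `length p ≤ m − (a / b)·log₂ m`, multiplied by `b` and exponentiated.
ShortProgram : TM → ℕ → ℕ → ℕ → Pred String 0ℓ
ShortProgram V m a b x = ∃[ p ] (V on p ⇓ x × 2 ^ (b * length p) * m ^ a ≤ 2 ^ (b * m))

-- If no program is short, a shortest one satisfies the reverse inequality at `a / b`, hence at
-- every rational above `e`, which puts `x` in `R V e`.
∉R⇒ShortProgram : ∀ {V e a b x} .{{_ : NonZero b}} .{{_ : NonZero (length x)}} → Lower e (+ a ℚᵘ./ b) →
  ¬ R V e x → ¬ ¬ ShortProgram V (length x) a b x
∉R⇒ShortProgram {V} {e} {a} {b} {x} l x∉R ¬short = x∉R
  λ { _ ((p , p⇓x , refl) , _) a′ b′ u →
    exponent-mono a b a′ b′ (<⇒≤ (Lower-Upper⇒< e a b a′ b′ l u))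
      (≰⇒≥ λ h → ¬short (p , p⇓x , h)) }

-- By determinism the chosen programs are pairwise distinct, so one of them, `p`, has index at least
-- `length xs - 1`. Its length bounds `length xs`, and its shortness finishes the estimate.
ShortProgram-count : ∀ V {m} a b .{{_ : NonZero b}} {xs} → Unique xs → All (ShortProgram V m a b) xs →
  length xs ^ b * m ^ a ≤ (2 * 2 ^ m) ^ b
-- An empty list has no program to select; the left side vanishes because `b` is nonzero.
ShortProgram-count V {m} a b {[]} _ _ = ≤-trans (≤-reflexive (cong (_* m ^ a) (0^n≡0 b))) z≤n
ShortProgram-count V {m} a b {xs@(_ ∷ _)} u short = begin
  length xs ^ b * m ^ a                        ≤⟨ *-monoˡ-≤ (m ^ a) (^-monoˡ-≤ b length≤) ⟩
  (2 ^ suc (length p)) ^ b * m ^ a             ≡⟨ cong (_* m ^ a) (^-distribʳ-* b 2 (2 ^ length p)) ⟩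
  2 ^ b * (2 ^ length p) ^ b * m ^ a           ≡⟨ *-assoc (2 ^ b) _ _ ⟩
  2 ^ b * ((2 ^ length p) ^ b * m ^ a)         ≡⟨ cong (λ i → 2 ^ b * (i * m ^ a)) (flip-^ (length p)) ⟩
  2 ^ b * (2 ^ (b * length p) * m ^ a)         ≤⟨ *-monoʳ-≤ (2 ^ b) p-short ⟩
  2 ^ b * 2 ^ (b * m)                          ≡⟨ cong (2 ^ b *_) (flip-^ m) ⟨
  2 ^ b * (2 ^ m) ^ b                          ≡⟨ ^-distribʳ-* b 2 (2 ^ m) ⟨
  (2 * 2 ^ m) ^ b                              ∎
  where
  open ≤-Reasoning
  flip-^ : ∀ n → (2 ^ n) ^ b ≡ 2 ^ (b * n)
  flip-^ n = trans (^-*-assoc 2 n b) (cong (2 ^_) (*-comm n b))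

  shortAt : ∀ i → ShortProgram V m a b (lookup xs i)
  shortAt i = All.lookup short (∈-lookup i)

  program : Fin (length xs) → String
  program i = proj₁ (shortAt i)

  program-injective : Injective _≡_ _≡_ program
  program-injective {i} {j} eq = Unique⇒lookup-injective u (Yields-deterministic V
    (proj₁ (proj₂ (shortAt i)))
    (subst (λ q → V on q ⇓ lookup xs j) (sym eq) (proj₁ (proj₂ (shortAt j)))))

  large : ∃[ i ] length xs ≤ suc (index (program i))
  large = injective⇒large-value (index ∘ program) (program-injective ∘ index-injective)

  p = program (proj₁ large)
  p-short = proj₂ (proj₂ (shortAt (proj₁ large)))

  length≤ : length xs ≤ 2 ^ suc (length p)
  length≤ = ≤-trans (proj₂ large) (≤-trans (n≤1+n _) (2+index≤2^1+length p))

densityEstimate : ∀ V e → DensityEstimate V e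
-- The constant 2 comes from the count of programs; lengths from 1 on make `length x` nonzero, as
-- `exponent-mono` requires.
densityEstimate V e = 2 , 1 , λ m m≥1 xs u exs a b l →
  decidable-stable (_ ≤? _) $ ¬¬-map (ShortProgram-count V a b u) $
    -- The list is finite, so the double negations on its members combine into one.
    All.sequenceM 0ℓ ¬¬-Monad $
      All.map (λ { (refl , x∉R) → ∉R⇒ShortProgram {V} {e} {{_}} {{>-nonZero m≥1}} l x∉R }) exs

-- Robustness of the estimates

-- The inclusion carries the estimate for `U` over at the exponent `d`; at `d +1` the counting bound
-- for `V` supplies it. Both exponents are at least 3, so `depends` applies to each.
densityTransfers : ∀ {ℓ} U V c → Universal U → InvarianceConstant U V c → ∀ d → 3 ≤ᵣ d →
  DensityTransfers U V d ℓ
densityTransfers U V c univ inv d 3≤d estimate =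
  estimate-d , densityEstimate V (d +1) , λ Φ depends →
    depends d 3≤d _ estimate-d , depends (d +1) (3≤⇒3≤+1 {d} 3≤d) _ (densityEstimate V (d +1))
  where
  estimate-d : AllBut-O[m^− d ] (R V (d +1))
  estimate-d = AllBut-mono d (2 ^ c) (R-transfers U c univ inv d 3≤d) estimate

theorem2p11 : ∀ {ℓ} (U U′ : TM) → Universal U → Universal U′ →
    (c : ℕ) → InvarianceConstant U U′ c →
    (d : ℝ) → 3 ≤ᵣ d →
    (∃[ N ] ∀ x → N ≤ length x →
    (R U d x → R U′ (d +1) x) × (R U′ d x → R U (d +1) x)) ×
    DensityTransfers U U′ d ℓ ×
    DensityTransfers U′ U d ℓ
theorem2p11 U U′ univ univ′ c inv d 3≤d =
  (2 ^ c , λ x 2^c≤ →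
    R-transfers U c univ inv d 3≤d x 2^c≤ , R-transfers U′ c univ′ inv′ d 3≤d x 2^c≤) ,
  densityTransfers U U′ c univ inv d 3≤d ,
  densityTransfers U′ U c univ′ inv′ d 3≤d
  where
  inv′ : InvarianceConstant U′ U c
  inv′ x k k′ k≡ k′≡ = subst (_≤ c) (∣-∣-comm k′ k) (inv x k′ k k′≡ k≡)
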